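{- If a graph $G$ has $n$ vertices and maximum degree $\Delta(G)=n-1$, then $G$ is antimagic.
   Context: All graphs are finite, undirected and simple; $\Delta(G)$ denotes the maximum degree of $G$. An antimagic labeling of a graph with $m$ edges and $n$ vertices is a bijection from the set of edges to the integers $1,\ldots,m$ such that all $n$ vertex sums are pairwise distinct, where a vertex sum is the sum of the labels of all edges incident with the same vertex. A graph is called antimagic if it has an antimagic labeling.
   Formalization: The case n = 2 is excluded: there the graph must be the single edge K₂, which has maximum degree 1 = n−1 but is not antimagic, since both vertex sums equal 1. -}

module Defs where

open import Data.Bool using (Bool; true; false; T; T?)
open import Data.Bool.Properties using (T-irrelevant)
open import Data.Fin using (Fin; zero; suc; toℕ; _<_; _<?_; _≟_)
open import Data.Fin.Properties using (<-irrelevant)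
open import Data.List using (List; []; _∷_; allFin; cartesianProduct; filter; length; map; mapMaybe; sum)
open import Data.List.Extrema.Nat using (max)
open import Data.List.Membership.Propositional using (_∈_)
open import Data.List.Membership.Propositional.Properties using (∈-allFin; ∈-cartesianProduct⁺)
open import Data.List.Relation.Unary.All using (All; []; _∷_)
open import Data.List.Relation.Unary.AllPairs using ([]; _∷_)
open import Data.List.Relation.Unary.Any using (here; there)
open import Data.List.Relation.Unary.Unique.Propositional using (Unique)
open import Data.List.Relation.Unary.Unique.Propositional.Properties using (allFin⁺; cartesianProduct⁺)
open import Data.Maybe using (Maybe; just; nothing)
import Data.Maybe as Maybe
open import Data.Nat using (ℕ; suc)
open import Data.Product using (Σ; ∃; _×_; _,_; proj₁)
open import Data.Sum using (_⊎_)
open import Function.Bundles using (_⤖_; module Bijection)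
open import Function.Definitions using (Injective)
open import Relation.Binary.PropositionalEquality using (_≡_; _≢_; refl; sym; trans; cong; cong₂)
open import Relation.Nullary using (¬_; Dec; yes; no; contradiction)
open import Relation.Nullary.Decidable using (_×-dec_; _⊎-dec_; dec⇒maybe)

record Graph (n : ℕ) : Set where
  field
    adj        : Fin n → Fin n → Bool
    adj-sym    : ∀ u v → adj u v ≡ adj v u
    adj-irrefl : ∀ v → adj v v ≡ false

module _ {n : ℕ} (G : Graph n) where
  open Graph G

  degree : Fin n → ℕ
  degree v = length (filter (λ w → T? (adj v w)) (allFin n))

  Δ : ℕ
  Δ = max 0 (map degree (allFin n))

  -- The undirected edge {u , v} is represented once, by the pair (u , v) with u < v.
  IsEdge : Fin n × Fin n → Set
  IsEdge (u , v) = u < v × T (adj u v)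

  isEdge? : ∀ p → Dec (IsEdge p)
  isEdge? (u , v) = u <? v ×-dec T? (adj u v)

  Edge : Set
  Edge = Σ (Fin n × Fin n) IsEdge

  toEdge : Fin n × Fin n → Maybe Edge
  toEdge p = Maybe.map (p ,_) (dec⇒maybe (isEdge? p))

  -- Each edge occurs exactly once; see edges-complete and edges-unique.
  edges : List Edge
  edges = mapMaybe toEdge (cartesianProduct (allFin n) (allFin n))

  Incident : Fin n → Edge → Set
  Incident w ((u , v) , _) = w ≡ u ⊎ w ≡ v

  incident? : ∀ w e → Dec (Incident w e)
  incident? w ((u , v) , _) = w ≟ u ⊎-dec w ≟ v

  Labeling : Set
  Labeling = Edge ⤖ Fin (length edges)

  -- Fin m is {0 , … , m - 1}; labels are 1 , … , m.
  label : Labeling → Edge → ℕ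
  label f e = suc (toℕ (Bijection.to f e))

  vertexSum : Labeling → Fin n → ℕ
  vertexSum f v = sum (map (label f) (filter (incident? v) edges))

  Antimagic : Set
  Antimagic = ∃ λ (f : Labeling) → Injective _≡_ _≡_ (vertexSum f)

module _ {A B : Set} (f : A → Maybe B) where

  ∈-mapMaybe : ∀ {x y xs} → x ∈ xs → f x ≡ just y → y ∈ mapMaybe f xs
  ∈-mapMaybe {x} (here refl) eq with f x | eq
  ... | just _ | refl = here refl
  ∈-mapMaybe {xs = z ∷ _} (there x∈xs) eq with f z
  ... | just _  = there (∈-mapMaybe x∈xs eq)
  ... | nothing = ∈-mapMaybe x∈xs eq

  module _ (g : B → A) (inv : ∀ x y → f x ≡ just y → g y ≡ x) where

    fresh : ∀ {x y xs} → g y ≡ x → All (x ≢_) xs → All (y ≢_) (mapMaybe f xs)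
    fresh _ [] = []
    fresh {xs = z ∷ _} gy≡x (x≢z ∷ x≢xs) with f z in eq
    ... | nothing = fresh gy≡x x≢xs
    ... | just y′ =
      (λ y≡y′ → x≢z (trans (sym gy≡x) (trans (cong g y≡y′) (inv z y′ eq)))) ∷ fresh gy≡x x≢xs

    mapMaybe-unique : ∀ {xs} → Unique xs → Unique (mapMaybe f xs)
    mapMaybe-unique [] = []
    mapMaybe-unique {x ∷ _} (x≢xs ∷ u) with f x in eq
    ... | nothing = mapMaybe-unique u
    ... | just y  = fresh (inv x y eq) x≢xs ∷ mapMaybe-unique u

module _ {n : ℕ} (G : Graph n) where

  toEdge-complete : ∀ (e : Edge G) → toEdge G (proj₁ e) ≡ just e
  toEdge-complete (p , u<v , a) with isEdge? G p
  ... | yes (u<v′ , a′) = cong (λ q → just (p , q)) (cong₂ _,_ (<-irrelevant u<v′ u<v) (T-irrelevant a′ a))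
  ... | no ¬e           = contradiction (u<v , a) ¬e

  toEdge-endpoints : ∀ p (e : Edge G) → toEdge G p ≡ just e → proj₁ e ≡ p
  toEdge-endpoints p e eq with isEdge? G p | eq
  ... | yes _ | refl = refl

  edges-complete : ∀ (e : Edge G) → e ∈ edges G
  edges-complete e@((u , v) , _) =
    ∈-mapMaybe (toEdge G) (∈-cartesianProduct⁺ (∈-allFin u) (∈-allFin v)) (toEdge-complete e)

  edges-unique : Unique (edges G)
  edges-unique =
    mapMaybe-unique (toEdge G) proj₁ toEdge-endpoints (cartesianProduct⁺ (allFin⁺ n) (allFin⁺ n))

-- On two vertices, maximum degree 1 forces the complete graph, which is not antimagic.
K₂ : Graph 2
K₂ = record { adj = adj ; adj-sym = adj-sym ; adj-irrefl = adj-irrefl }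
  where
  adj : Fin 2 → Fin 2 → Bool
  adj zero       zero       = false
  adj zero       (suc zero) = true
  adj (suc zero) zero       = true
  adj (suc zero) (suc zero) = false

  adj-sym : ∀ u v → adj u v ≡ adj v u
  adj-sym zero       zero       = refl
  adj-sym zero       (suc zero) = refl
  adj-sym (suc zero) zero       = refl
  adj-sym (suc zero) (suc zero) = refl

  adj-irrefl : ∀ v → adj v v ≡ false
  adj-irrefl zero       = refl
  adj-irrefl (suc zero) = refl

Δ-K₂ : Δ K₂ ≡ 1
Δ-K₂ = refl

K₂-not-antimagic : ¬ Antimagic K₂
K₂-not-antimagic (f , inj) with inj {zero} {suc zero} refl
... | ()

{-# OPTIONS --safe #-}

-- Let c be a vertex of degree n - 1.  Label the k edges avoiding c by 1 , … , k in any order, and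
-- order the other vertices by the partial sums this produces.  Labelling their edges to c by
-- k + 1 , … , k + n - 1 in that order makes the sums of the vertices other than c strictly
-- increasing.  Such a vertex lies on at most n - 2 edges avoiding c, so its sum is at most
-- (n - 2) k + (k + n - 1) = (n - 1) (k + 1), which for n ≥ 3 is less than the sum
-- (k + 1) + … + (k + n - 1) at c.
module Submission where

open import Defs
open import Data.Bool using (T; T?; if_then_else_)
open import Data.Bool.Properties using (T-irrelevant)
open import Data.Empty using (⊥-elim)
open import Data.Fin as Fin using (Fin; zero; suc; toℕ; cast)
open import Data.Fin.Properties using (_≟_; toℕ-cast; toℕ-injective; injective⇒≤) renaming (<-asym to <ᶠ-asym; <-cmp to <ᶠ-cmp; <-irrelevant to <ᶠ-irrelevant)
open import Data.List using (List; []; _∷_; _++_; length; map; filter; lookup; allFin)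
open import Data.List.Extrema.Nat using (argmax-sel)
open import Data.List.Membership.Propositional using (_∈_)
open import Data.List.Membership.Propositional.Properties using (∈-allFin; ∈-lookup; ∈-filter⁺; ∈-filter⁻; ∈-map⁺; ∈-map⁻)
import Data.List.Membership.Setoid.Properties as SetoidMembership
open import Data.List.Properties using (length-map; length-tabulate)
open import Data.List.Relation.Binary.Permutation.Propositional using (_↭_; ↭-refl; ↭-sym; ↭-trans; ↭⇒↭ₛ)
open import Data.List.Relation.Binary.Permutation.Propositional.Properties using (↭-length; ∈-resp-↭; All-resp-↭; filter-↭; map⁺; ++⁺ˡ; ++-comm)
open import Data.List.Relation.Binary.Permutation.Setoid.Properties using (Unique-resp-↭)
open import Data.List.Relation.Binary.Subset.Propositional using (_⊆_)
open import Data.List.Relation.Ternary.Interleaving.Propositional using (toPermutation)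
import Data.List.Relation.Ternary.Interleaving.Propositional.Properties as Interleaving
open import Data.List.Relation.Unary.All as All using (All; []; _∷_)
open import Data.List.Relation.Unary.All.Properties using (all-filter; ¬Any⇒All¬)
open import Data.List.Relation.Unary.AllPairs using (AllPairs; []; _∷_)
import Data.List.Relation.Unary.AllPairs.Properties as AllPairs
open import Data.List.Relation.Unary.Any using (here; there; index)
open import Data.List.Relation.Unary.Any.Properties using (lookup-index)
open import Data.List.Relation.Unary.Sorted.TotalOrder.Properties using (Sorted⇒AllPairs)
open import Data.List.Relation.Unary.Unique.Propositional using (Unique)
open import Data.List.Relation.Unary.Unique.Propositional.Properties using (allFin⁺; filter⁺)
import Data.List.Sort as Sort
open import Data.Nat using (ℕ; zero; suc; _+_; _*_; _≤_; _<_; z≤n; s≤s)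
open import Data.Nat.ListAction using (sum)
open import Data.Nat.ListAction.Properties using (sum-↭)
open import Data.Nat.Properties using (≤-decTotalOrder; ≤-refl; ≤-reflexive; ≤-trans; <⇒≢; <⇒≱; <-irrefl; +-suc; +-identityʳ; +-assoc; +-comm; +-mono-≤; +-mono-≤-<; +-monoʳ-≤; +-monoˡ-≤; *-monoˡ-≤; *-monoʳ-≤; *-suc; m≤n+m; m≤m+n; n≤1+n; module ≤-Reasoning)
open import Data.Product using (_×_; _,_; proj₁; proj₂; ∃)
open import Data.Sum using (inj₁; inj₂)
open import Function using (_∘_)
open import Function.Bundles using (mk⤖)
open import Function.Definitions using (Injective; Surjective)
open import Relation.Binary.Bundles using (DecTotalOrder)
import Relation.Binary.Construct.On as On
open import Relation.Binary.Definitions using (tri<; tri≈; tri>)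
open import Relation.Binary.PropositionalEquality using (_≡_; _≢_; refl; sym; trans; cong; cong₂; subst; setoid; module ≡-Reasoning)
open import Relation.Nullary using (¬_; yes; no; does; contradiction)
open import Relation.Nullary.Decidable using (¬?)
open import Relation.Unary using (Decidable)

-- Counting with repetition-free lists.

module _ {A : Set} where

  lookup-injective : ∀ {xs : List A} → Unique xs → Injective _≡_ _≡_ (lookup xs)
  lookup-injective (_ ∷ _)   {zero}  {zero}  _  = refl
  lookup-injective (x≢ ∷ _)  {zero}  {suc j} eq = contradiction eq (All.lookup x≢ (∈-lookup j))
  lookup-injective (x≢ ∷ _)  {suc i} {zero}  eq = contradiction (sym eq) (All.lookup x≢ (∈-lookup i))
  lookup-injective (_ ∷ uxs) {suc i} {suc j} eq = cong suc (lookup-injective uxs eq)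

  -- Sending a position in `xs` to the position of the same element in `ys` is injective: a position
  -- determines its element, and `xs` has no repeats. All vertex counts below go through this.
  unique-⊆⇒length≤ : ∀ {xs ys : List A} → Unique xs → xs ⊆ ys → length xs ≤ length ys
  unique-⊆⇒length≤ {xs} uxs xs⊆ys = injective⇒≤ {f = λ i → index (xs⊆ys (∈-lookup i))}
    λ {i} {j} eq → lookup-injective uxs
      (SetoidMembership.index-injective (setoid A) (xs⊆ys (∈-lookup i)) (xs⊆ys (∈-lookup j)) eq)

  -- Injectivity is asked only on `P` because `opposite v` is in general injective only on the edges
  -- at `v`.
  unique-map : ∀ {B : Set} {P : A → Set} {f : A → B} {xs} →
    (∀ x y → P x → P y → f x ≡ f y → x ≡ y) → All P xs → Unique xs → Unique (map f xs)
  unique-map _ [] [] = []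
  unique-map {f = f} inj (px ∷ pxs) (x≢ ∷ uxs) = ¬Any⇒All¬ _ fresh-image ∷ unique-map inj pxs uxs
    where
    fresh-image : ¬ (f _ ∈ map f _)
    fresh-image fx∈ with ∈-map⁻ f fx∈
    ... | y , y∈ , eq = All.lookup x≢ y∈ (inj _ y px (All.lookup pxs y∈) eq)

-- The sum of the labels of the elements satisfying P, when the list carries k + 1 , k + 2 , …
labelSum : ∀ {A : Set} {P : A → Set} → Decidable P → ℕ → List A → ℕ
labelSum P? k []       = 0
labelSum P? k (x ∷ xs) = (if does (P? x) then suc k else 0) + labelSum P? (suc k) xs

-- Splitting, bounding and transporting label sums.

module _ {A : Set} {P : A → Set} (P? : Decidable P) where

  labelSum-++ : ∀ k xs ys → labelSum P? k (xs ++ ys) ≡ labelSum P? k xs + labelSum P? (k + length xs) ys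
  labelSum-++ k [] ys = cong (λ j → labelSum P? j ys) (sym (+-identityʳ k))
  labelSum-++ k (x ∷ xs) ys = begin
    l + labelSum P? (suc k) (xs ++ ys)
      ≡⟨ cong (l +_) (labelSum-++ (suc k) xs ys) ⟩
    l + (labelSum P? (suc k) xs + labelSum P? (suc k + length xs) ys)
      ≡⟨ cong (λ j → l + (labelSum P? (suc k) xs + labelSum P? j ys)) (sym (+-suc k (length xs))) ⟩
    l + (labelSum P? (suc k) xs + labelSum P? (k + suc (length xs)) ys)
      ≡⟨ sym (+-assoc l _ _) ⟩
    l + labelSum P? (suc k) xs + labelSum P? (k + suc (length xs)) ys ∎
    where
    open ≡-Reasoning
    l = if does (P? x) then suc k else 0

  -- Turns a vertex sum into a recursion along the labelled list. The offset `k` has to vary, since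
  -- each tail starts one label later.
  sum-filter≡labelSum : ∀ (g : A → ℕ) k xs → (∀ i → g (lookup xs i) ≡ suc (k + toℕ i)) →
    sum (map g (filter P? xs)) ≡ labelSum P? k xs
  sum-filter≡labelSum g k []       _  = refl
  sum-filter≡labelSum g k (x ∷ xs) eq
    with P? x | sum-filter≡labelSum g (suc k) xs (λ i → trans (eq (suc i)) (cong suc (+-suc k (toℕ i))))
  ... | yes _ | ih = cong₂ _+_ (trans (eq zero) (cong suc (+-identityʳ k))) ih
  ... | no _  | ih = ih

  -- No label on the list exceeds `k + length xs`, so each selected entry contributes at most that
  -- much.
  labelSum-≤ : ∀ k xs → labelSum P? k xs ≤ length (filter P? xs) * (k + length xs)
  labelSum-≤ k []       = z≤n
  labelSum-≤ k (x ∷ xs) with P? x | labelSum-≤ (suc k) xs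
  ... | yes _ | ih rewrite +-suc k (length xs) = +-mono-≤ (s≤s (m≤m+n k (length xs))) ih
  ... | no _  | ih rewrite +-suc k (length xs) = ih

  labelSum-all-≥ : ∀ k {xs} → All P xs → length xs * suc k ≤ labelSum P? k xs
  labelSum-all-≥ k [] = z≤n
  labelSum-all-≥ k {x ∷ xs} (px ∷ pxs) with P? x
  ... | yes _  = +-monoʳ-≤ (suc k)
    (≤-trans (*-monoʳ-≤ (length xs) (n≤1+n (suc k))) (labelSum-all-≥ (suc k) pxs))
  ... | no ¬px = contradiction px ¬px

  -- Every label is at least `k + 1`, and the second one is `k + 2`, which makes the bound strict.
  -- The hypothesis `3 ≤ n` will supply that second entry.
  labelSum-all-> : ∀ k {xs} → 2 ≤ length xs → All P xs → length xs * suc k < labelSum P? k xs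
  labelSum-all-> k {x ∷ []}     (s≤s ()) _
  labelSum-all-> k {x ∷ y ∷ xs} _ (px ∷ pxs) with P? x
  ... | no ¬px = contradiction px ¬px
  ... | yes _  = +-mono-≤-< (≤-refl {suc k})
    (≤-trans (s≤s (+-monoʳ-≤ (suc k) (*-monoʳ-≤ (length xs) (n≤1+n (suc k)))))
             (labelSum-all-≥ (suc k) pxs))

  -- The equivalence is asked only of the entries: incidence with `v` matches equality of `v` with
  -- `opposite c` only on edges at `c`.
  labelSum-map : ∀ {B : Set} {Q : B → Set} (Q? : Decidable Q) (f : A → B) k {xs} →
    All (λ x → (P x → Q (f x)) × (Q (f x) → P x)) xs → labelSum P? k xs ≡ labelSum Q? k (map f xs)
  labelSum-map Q? f k [] = refl
  labelSum-map Q? f k {x ∷ xs} ((to , from) ∷ eqs) with P? x | Q? (f x)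
  ... | yes _  | yes _  = cong (suc k +_) (labelSum-map Q? f (suc k) eqs)
  ... | no _   | no _   = labelSum-map Q? f (suc k) eqs
  ... | yes px | no ¬qx = contradiction (to px) ¬qx
  ... | no ¬px | yes qx = contradiction (from qx) ¬px

-- Label sums at a single vertex, and separation by sorting.

module _ {n : ℕ} where

  labelSum-absent : ∀ (v : Fin n) k {xs} → All (v ≢_) xs → labelSum (v ≟_) k xs ≡ 0
  labelSum-absent v k [] = refl
  labelSum-absent v k {x ∷ xs} (v≢x ∷ v≢xs) with v ≟ x
  ... | yes v≡x = contradiction v≡x v≢x
  ... | no _    = labelSum-absent v (suc k) v≢xs

  labelSum-head : ∀ (v : Fin n) k {xs} → All (v ≢_) xs → labelSum (v ≟_) k (v ∷ xs) ≡ suc k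
  labelSum-head v k v≢xs with v ≟ v
  ... | yes _  = trans (cong (suc k +_) (labelSum-absent v (suc k) v≢xs)) (+-identityʳ (suc k))
  ... | no v≢v = contradiction refl v≢v

  labelSum-tail : ∀ {v x : Fin n} k xs → v ≢ x → labelSum (v ≟_) k (x ∷ xs) ≡ labelSum (v ≟_) (suc k) xs
  labelSum-tail {v} {x} k xs v≢x with v ≟ x
  ... | yes v≡x = contradiction v≡x v≢x
  ... | no _    = refl

  labelSum-member-> : ∀ {v : Fin n} k {xs} → v ∈ xs → k < labelSum (v ≟_) k xs
  labelSum-member-> {v} k {x ∷ xs} v∈ with v ≟ x
  ... | yes _  = m≤m+n (suc k) _
  labelSum-member-> k (here v≡x)  | no v≢x = contradiction v≡x v≢x
  labelSum-member-> k (there v∈) | no _   = ≤-trans (n≤1+n _) (labelSum-member-> (suc k) v∈)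

  -- At most one entry equals `v`, so the sum is 0 or a single label.
  labelSum-unique-≤ : ∀ (v : Fin n) k {xs} → Unique xs → labelSum (v ≟_) k xs ≤ k + length xs
  labelSum-unique-≤ v k [] = z≤n
  labelSum-unique-≤ v k {x ∷ xs} (x≢ ∷ uxs) rewrite +-suc k (length xs) with v ≟ x
  ... | no _     = labelSum-unique-≤ v (suc k) uxs
  ... | yes refl = begin
    suc k + labelSum (v ≟_) (suc k) xs ≡⟨ cong (suc k +_) (labelSum-absent v (suc k) x≢) ⟩
    suc k + 0                          ≤⟨ +-monoʳ-≤ (suc k) z≤n ⟩
    suc k + length xs                  ∎
    where open ≤-Reasoning

  module _ (w : Fin n → ℕ) where

    -- The head `u` has label `k + 1` and `v` a larger one, so the inequality is strict even when
    -- `w u` and `w v` tie.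
    sorted-head-< : ∀ {u v} k {xs} → All (u ≢_) xs → All (λ x → w u ≤ w x) xs → v ∈ xs →
      w u + labelSum (u ≟_) k (u ∷ xs) < w v + labelSum (v ≟_) k (u ∷ xs)
    sorted-head-< {u} {v} k {xs} u≢ w≤ v∈
      rewrite labelSum-head u k u≢ | labelSum-tail k xs (λ v≡u → All.lookup u≢ v∈ (sym v≡u))
      = +-mono-≤-< (All.lookup w≤ v∈) (labelSum-member-> (suc k) v∈)

    -- Entries equal to neither vertex contribute to neither sum and are peeled off until `u` or `v`
    -- is the head, where `sorted-head-<` decides.
    sorted-labelSums-distinct : ∀ {u v} k {xs} → Unique xs → AllPairs (λ x y → w x ≤ w y) xs →
      u ∈ xs → v ∈ xs → u ≢ v → w u + labelSum (u ≟_) k xs ≢ w v + labelSum (v ≟_) k xs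
    sorted-labelSums-distinct k _ _ (here refl) (here refl) u≢v _ = u≢v refl
    sorted-labelSums-distinct k (x≢ ∷ _) (w≤ ∷ _) (here refl) (there v∈) _ =
      <⇒≢ (sorted-head-< k x≢ w≤ v∈)
    sorted-labelSums-distinct k (x≢ ∷ _) (w≤ ∷ _) (there u∈) (here refl) _ =
      <⇒≢ (sorted-head-< k x≢ w≤ u∈) ∘ sym
    sorted-labelSums-distinct k {x ∷ xs} (x≢ ∷ uxs) (_ ∷ sxs) (there u∈) (there v∈) u≢v
      rewrite labelSum-tail k xs (λ u≡x → All.lookup x≢ u∈ (sym u≡x))
            | labelSum-tail k xs (λ v≡x → All.lookup x≢ v∈ (sym v≡x))
      = sorted-labelSums-distinct (suc k) uxs sxs u∈ v∈ u≢v

-- Edges and their opposite endpoints.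

module _ {n : ℕ} (G : Graph n) where
  open Graph G

  edge-≡ : ∀ {e e′ : Edge G} → proj₁ e ≡ proj₁ e′ → e ≡ e′
  edge-≡ {_ , u<v , a} {_ , u<v′ , a′} refl =
    cong (_ ,_) (cong₂ _,_ (<ᶠ-irrelevant u<v u<v′) (T-irrelevant a a′))

  -- The endpoint of e other than v; meaningful only when v is incident with e.
  opposite : Fin n → Edge G → Fin n
  opposite v ((a , b) , _) = if does (v ≟ a) then b else a

  opposite-incident : ∀ v e → Incident G (opposite v e) e
  opposite-incident v ((a , b) , _) with v ≟ a
  ... | yes _ = inj₂ refl
  ... | no _  = inj₁ refl

  opposite-≢ : ∀ v e → v ≢ opposite v e
  opposite-≢ v ((a , b) , a<b , _) eq with v ≟ a
  -- Here `b` is also `v`, so `a<b` becomes `v < v`, which asymmetry refutes.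
  ... | yes refl = <ᶠ-asym (subst (v Fin.<_) (sym eq) a<b) (subst (v Fin.<_) (sym eq) a<b)
  ... | no v≢a   = v≢a eq

  incident⇒opposite : ∀ {v w} e → Incident G v e → w ≢ v → Incident G w e → w ≡ opposite v e
  incident⇒opposite {v} {w} ((a , b) , _) v∈e w≢v w∈e with v ≟ a | v∈e | w∈e
  ... | yes refl | _        | inj₁ w≡a = contradiction w≡a w≢v
  ... | yes refl | _        | inj₂ w≡b = w≡b
  ... | no _     | _        | inj₁ w≡a = w≡a
  ... | no v≢a   | inj₁ v≡a | inj₂ _   = contradiction v≡a v≢a
  ... | no _     | inj₂ refl | inj₂ w≡b = contradiction w≡b w≢v

  -- Edges are stored with the smaller endpoint first. If `v` came first in one edge and second in
  -- the other, a common opposite endpoint would lie both above and below `v`.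
  opposite-injective : ∀ v e e′ → Incident G v e → Incident G v e′ →
    opposite v e ≡ opposite v e′ → e ≡ e′
  opposite-injective v ((a , b) , a<b , _) ((a′ , b′) , a′<b′ , _) v∈e v∈e′ eq
    with v ≟ a | v ≟ a′ | v∈e | v∈e′
  ... | yes refl | yes refl | _         | _         = edge-≡ (cong (_ ,_) eq)
  ... | yes refl | no v≢a′  | _         | inj₁ v≡a′ = contradiction v≡a′ v≢a′
  ... | yes refl | no _     | _         | inj₂ refl =
    contradiction (subst (Fin._< _) (sym eq) a′<b′) (<ᶠ-asym a<b)
  ... | no v≢a   | _        | inj₁ v≡a  | _         = contradiction v≡a v≢a
  ... | no _     | yes refl | inj₂ refl | _         =
    contradiction (subst (Fin._< _) eq a<b) (<ᶠ-asym a′<b′)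
  ... | no _     | no v≢a′  | inj₂ refl | inj₁ v≡a′ = contradiction v≡a′ v≢a′
  ... | no _     | no _     | inj₂ refl | inj₂ refl = edge-≡ (cong (_, _) eq)

  adj⇒edge : ∀ {u v} → u ≢ v → T (adj u v) → ∃ λ e → Incident G u e × Incident G v e
  adj⇒edge {u} {v} u≢v a with <ᶠ-cmp u v
  ... | tri< u<v _ _ = ((u , v) , u<v , a) , inj₁ refl , inj₂ refl
  ... | tri≈ _ u≡v _ = contradiction u≡v u≢v
  ... | tri> _ _ v<u = ((v , u) , v<u , subst T (adj-sym u v) a) , inj₂ refl , inj₁ refl

  -- Labelings from orderings of the edges.

  module _ (L : List (Edge G)) (L↭edges : L ↭ edges G) where

    private
      L-unique : Unique L
      L-unique = Unique-resp-↭ (setoid _) (↭⇒↭ₛ (↭-sym L↭edges)) (edges-unique G)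

      ∈L : ∀ e → e ∈ L
      ∈L e = ∈-resp-↭ (↭-sym L↭edges) (edges-complete G e)

      |L|≡ : length L ≡ length (edges G)
      |L|≡ = ↭-length L↭edges

      position : Edge G → Fin (length (edges G))
      position e = cast |L|≡ (index (∈L e))

      toℕ-position : ∀ e → toℕ (position e) ≡ toℕ (index (∈L e))
      toℕ-position e = toℕ-cast |L|≡ (index (∈L e))

      -- The proof `∈L` comes through `edges G` and the permutation, so it does not point at `i` by
      -- construction; the absence of repeats in `L` forces it to.
      index-lookup : ∀ i → index (∈L (lookup L i)) ≡ i
      index-lookup i = lookup-injective L-unique (sym (lookup-index (∈L (lookup L i))))

      position-injective : Injective _≡_ _≡_ position
      position-injective {e} {e′} eq = SetoidMembership.index-injective (setoid _) (∈L e) (∈L e′)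
        (toℕ-injective (trans (sym (toℕ-position e)) (trans (cong toℕ eq) (toℕ-position e′))))

      position-surjective : Surjective _≡_ _≡_ position
      position-surjective j = lookup L i , λ { refl → toℕ-injective (begin
        toℕ (position (lookup L i))   ≡⟨ toℕ-position (lookup L i) ⟩
        toℕ (index (∈L (lookup L i))) ≡⟨ cong toℕ (index-lookup i) ⟩
        toℕ i                         ≡⟨ toℕ-cast (sym |L|≡) j ⟩
        toℕ j                         ∎) }
        where
        open ≡-Reasoning
        i = cast (sym |L|≡) j

    orderLabeling : Labeling G
    orderLabeling = mk⤖ (position-injective , position-surjective)

    -- Permuting terms preserves a sum, so it may be taken along `L`, where the entry at position
    -- `i` has label `i + 1`.
    vertexSum-orderLabeling : ∀ v → vertexSum G orderLabeling v ≡ labelSum (incident? G v) 0 L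
    vertexSum-orderLabeling v = begin
      sum (map (label G orderLabeling) (filter (incident? G v) (edges G)))
        ≡⟨ sum-↭ (map⁺ (label G orderLabeling) (filter-↭ (incident? G v) (↭-sym L↭edges))) ⟩
      sum (map (label G orderLabeling) (filter (incident? G v) L))
        ≡⟨ sum-filter≡labelSum (incident? G v) (label G orderLabeling) 0 L
             (λ i → cong suc (trans (toℕ-position (lookup L i)) (cong toℕ (index-lookup i)))) ⟩
      labelSum (incident? G v) 0 L ∎
      where open ≡-Reasoning

  -- The labeling around a dominating vertex.

  module Dominated (c : Fin n) (dominating : ∀ {v} → c ≢ v → T (adj c v)) (3≤n : 3 ≤ n) where

    inner : List (Edge G)
    inner = filter (¬? ∘ incident? G c) (edges G)

    k : ℕ
    k = length inner

    partialSum : Fin n → ℕ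
    partialSum v = labelSum (incident? G v) 0 inner

    -- Spokes with equal partial sums compare as equal; any order among them will do, since their
    -- labels still separate the vertex sums.
    byPartialSum : DecTotalOrder _ _ _
    byPartialSum = On.decTotalOrder ≤-decTotalOrder (partialSum ∘ opposite c)

    open Sort byPartialSum using (sort; sort-↭; sort-↗)

    spokes : List (Edge G)
    spokes = sort (filter (incident? G c) (edges G))

    -- The vertices other than `c`, in the order in which their edges to `c` are labelled.
    rim : List (Fin n)
    rim = map (opposite c) spokes

    order-↭ : inner ++ spokes ↭ edges G
    -- The interleaving puts the edges at `c` first; the swap is there because `inner` must take the
    -- smallest labels.
    order-↭ = ↭-trans (++⁺ˡ inner (sort-↭ _)) (↭-trans (++-comm inner _)
      (↭-sym (toPermutation (Interleaving.filter⁺ (incident? G c) (edges G)))))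

    spokes-incident : All (Incident G c) spokes
    spokes-incident = All-resp-↭ (↭-sym (sort-↭ _)) (all-filter (incident? G c) (edges G))

    rim-unique : Unique rim
    rim-unique = unique-map (opposite-injective c) spokes-incident
      (Unique-resp-↭ (setoid _) (↭⇒↭ₛ (↭-sym (sort-↭ _))) (filter⁺ (incident? G c) (edges-unique G)))

    rim-sorted : AllPairs (λ u v → partialSum u ≤ partialSum v) rim
    rim-sorted = AllPairs.map⁺ (Sorted⇒AllPairs (DecTotalOrder.totalOrder byPartialSum) (sort-↗ _))

    -- Domination enters here: it provides the spoke from `c` to `v`.
    ∈-rim : ∀ {v} → c ≢ v → v ∈ rim
    ∈-rim {v} c≢v with adj⇒edge c≢v (dominating c≢v)
    ... | e , c∈e , v∈e = subst (_∈ rim) (sym (incident⇒opposite e c∈e (c≢v ∘ sym) v∈e))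
      (∈-map⁺ (opposite c) (∈-resp-↭ (↭-sym (sort-↭ _)) (∈-filter⁺ (incident? G c) (edges-complete G e) c∈e)))

    -- Every vertex is `c` or on the rim, so `n` is at most `suc (length rim)`.
    2≤|rim| : 2 ≤ length rim
    2≤|rim| with ≤-trans 3≤n (≤-trans (≤-reflexive (sym (length-tabulate (λ (i : Fin n) → i))))
                   (unique-⊆⇒length≤ {ys = c ∷ rim} (allFin⁺ n) (λ {v} _ → ∈-c∷rim v)))
      where
      ∈-c∷rim : ∀ v → v ∈ c ∷ rim
      ∈-c∷rim v with c ≟ v
      ... | yes c≡v = here (sym c≡v)
      ... | no c≢v  = there (∈-rim c≢v)
    ... | s≤s 2≤ = 2≤

    innerDegree : Fin n → ℕ
    innerDegree v = length (filter (incident? G v) inner)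

    -- The vertex `v` and the far ends of its inner edges are distinct and differ from `c`, hence
    -- lie on the rim; counting `v` itself gives strictness.
    innerDegree<|rim| : ∀ {v} → c ≢ v → innerDegree v < length rim
    innerDegree<|rim| {v} c≢v = subst (λ d → suc d ≤ length rim) (length-map (opposite v) innerAt)
      (unique-⊆⇒length≤ (¬Any⇒All¬ _ v∉ ∷ unique-map (opposite-injective v) (all-filter (incident? G v) inner)
        (filter⁺ (incident? G v) (filter⁺ (¬? ∘ incident? G c) (edges-unique G)))) ⊆rim)
      where
      innerAt : List (Edge G)
      innerAt = filter (incident? G v) inner

      v∉ : ¬ (v ∈ map (opposite v) innerAt)
      v∉ v∈ with ∈-map⁻ (opposite v) v∈
      ... | e , _ , eq = opposite-≢ v e eq

      ⊆rim : v ∷ map (opposite v) innerAt ⊆ rim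
      ⊆rim (here refl) = ∈-rim c≢v
      ⊆rim (there u∈) with ∈-map⁻ (opposite v) u∈
      -- If the far end of `e` were `c`, then `e` would be an edge at `c`, yet it comes from
      -- `inner`.
      ... | e , e∈ , refl = ∈-rim λ c≡ →
        proj₂ (∈-filter⁻ (¬? ∘ incident? G c) {xs = edges G} (proj₁ (∈-filter⁻ (incident? G v) e∈)))
          (subst (λ u → Incident G u e) (sym c≡) (opposite-incident v e))

    f : Labeling G
    f = orderLabeling (inner ++ spokes) order-↭

    vertexSum-split : ∀ v → vertexSum G f v ≡ partialSum v + labelSum (incident? G v) k spokes
    vertexSum-split v = trans (vertexSum-orderLabeling _ order-↭ v) (labelSum-++ (incident? G v) 0 inner spokes)

    -- For `v` other than `c`, a spoke contains `v` exactly when `v` is its end opposite `c`, so the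
    -- sum over spokes becomes one over the rim.
    vertexSum-rim : ∀ {v} → c ≢ v → vertexSum G f v ≡ partialSum v + labelSum (v ≟_) k rim
    vertexSum-rim {v} c≢v = trans (vertexSum-split v) (cong (partialSum v +_)
      (labelSum-map (incident? G v) (v ≟_) (opposite c) k
        (All.map (λ {e} c∈e → incident⇒opposite e c∈e (c≢v ∘ sym) ,
                              λ v≡ → subst (λ u → Incident G u e) (sym v≡) (opposite-incident c e))
                 spokes-incident)))

    -- Here `length rim` stands for n - 1, and both sums are compared with `length rim * suc k`.
    vertexSum-< : ∀ {v} → c ≢ v → vertexSum G f v < vertexSum G f c
    vertexSum-< {v} c≢v = begin-strict
      vertexSum G f v                           ≡⟨ vertexSum-rim c≢v ⟩
      partialSum v + labelSum (v ≟_) k rim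
        ≤⟨ +-mono-≤ (labelSum-≤ (incident? G v) 0 inner) (labelSum-unique-≤ v k rim-unique) ⟩
      innerDegree v * k + (k + length rim)      ≡⟨ sym (+-assoc (innerDegree v * k) k _) ⟩
      innerDegree v * k + k + length rim        ≡⟨ cong (_+ length rim) (+-comm (innerDegree v * k) k) ⟩
      -- The extra `k`, from the bound on the spoke label, is absorbed because the inner degree is
      -- strictly below `length rim`.
      suc (innerDegree v) * k + length rim      ≤⟨ +-monoˡ-≤ (length rim) (*-monoˡ-≤ k (innerDegree<|rim| c≢v)) ⟩
      length rim * k + length rim               ≡⟨ +-comm (length rim * k) _ ⟩
      length rim + length rim * k               ≡⟨ sym (*-suc (length rim) k) ⟩
      length rim * suc k                        ≡⟨ cong (_* suc k) |rim|≡ ⟩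
      length spokes * suc k
        <⟨ labelSum-all-> (incident? G c) k (subst (2 ≤_) |rim|≡ 2≤|rim|) spokes-incident ⟩
      labelSum (incident? G c) k spokes         ≤⟨ m≤n+m _ (partialSum c) ⟩
      partialSum c + labelSum (incident? G c) k spokes ≡⟨ sym (vertexSum-split c) ⟩
      vertexSum G f c                           ∎
      where
      open ≤-Reasoning
      |rim|≡ : length rim ≡ length spokes
      |rim|≡ = length-map (opposite c) spokes

    vertexSum-injective : Injective _≡_ _≡_ (vertexSum G f)
    vertexSum-injective {u} {v} eq with c ≟ u | c ≟ v | u ≟ v
    ... | yes refl | yes refl | _       = refl
    ... | yes refl | no c≢v   | _       = contradiction (sym eq) (<⇒≢ (vertexSum-< c≢v))
    ... | no c≢u   | yes refl | _       = contradiction eq (<⇒≢ (vertexSum-< c≢u))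
    ... | no _     | no _     | yes u≡v = u≡v
    ... | no c≢u   | no c≢v   | no u≢v  = contradiction
      (trans (sym (vertexSum-rim c≢u)) (trans eq (vertexSum-rim c≢v)))
      (sorted-labelSums-distinct partialSum k rim-unique rim-sorted (∈-rim c≢u) (∈-rim c≢v) u≢v)

    antimagic : Antimagic G
    antimagic = f , vertexSum-injective

  -- From the maximum degree to a dominating vertex.

  Δ-attained : Δ G ≢ 0 → ∃ λ c → degree G c ≡ Δ G
  Δ-attained Δ≢0 with argmax-sel (λ d → d) 0 (map (degree G) (allFin n))
  -- The maximum is taken with default 0, which need not be a degree.
  ... | inj₁ Δ≡0 = contradiction Δ≡0 Δ≢0
  ... | inj₂ Δ∈ with ∈-map⁻ (degree G) Δ∈
  ...   | c , _ , Δ≡ = c , sym Δ≡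

  -- Otherwise `c`, `v` and the n - 1 neighbours of `c` would be n + 1 distinct vertices.
  full-degree⇒dominating : ∀ {c} → suc (degree G c) ≡ n → ∀ {v} → c ≢ v → T (adj c v)
  full-degree⇒dominating {c} full {v} c≢v with T? (adj c v)
  ... | yes a = a
  ... | no ¬a = ⊥-elim (<-irrefl refl (begin-strict
    n                               ≡⟨ sym full ⟩
    suc (degree G c)                <⟨ unique-⊆⇒length≤ {ys = allFin n}
                                         ((c≢v ∷ ¬Any⇒All¬ _ c∉) ∷ ¬Any⇒All¬ _ v∉ ∷ filter⁺ adj? (allFin⁺ n))
                                         (λ {u} _ → ∈-allFin u) ⟩
    length (allFin n)               ≡⟨ length-tabulate (λ (i : Fin n) → i) ⟩
    n                               ∎))
    where
    open ≤-Reasoning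
    adj? : Decidable (λ w → T (adj c w))
    adj? w = T? (adj c w)

    c∉ : ¬ (c ∈ filter adj? (allFin n))
    c∉ c∈ = subst T (adj-irrefl c) (proj₂ (∈-filter⁻ adj? {xs = allFin n} c∈))

    v∉ : ¬ (v ∈ filter adj? (allFin n))
    v∉ v∈ = ¬a (proj₂ (∈-filter⁻ adj? {xs = allFin n} v∈))

  full-Δ⇒antimagic : 3 ≤ n → suc (Δ G) ≡ n → Antimagic G
  full-Δ⇒antimagic 3≤n Δ≡ =
    -- A maximum degree of 0 would give n = 1; `3 ≤ n` is read as `2 < n`.
    let c , deg≡ = Δ-attained λ Δ≡0 → <⇒≱ 3≤n (≤-trans (≤-reflexive (trans (sym Δ≡) (cong suc Δ≡0))) (s≤s z≤n))
    in Dominated.antimagic c (full-degree⇒dominating (trans (cong suc deg≡) Δ≡)) 3≤n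

lemma4p1 : ∀ (n : ℕ) (G : Graph n) → n ≢ 2 → suc (Δ G) ≡ n → Antimagic G
-- The degree equation rules out n = 0; on one vertex there is no pair to separate.
lemma4p1 1 G _ _ = orderLabeling G (edges G) ↭-refl , λ { {zero} {zero} _ → refl }
lemma4p1 2 _ n≢2 _ = contradiction refl n≢2
lemma4p1 (suc (suc (suc _))) G _ Δ≡ = full-Δ⇒antimagic G (s≤s (s≤s (s≤s z≤n))) Δ≡
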